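{- Let $q = p^l$ with $p$ prime and $l \geq 1$ an integer, and let $\mathbb{F}_q$ be the finite field with $q$ elements. Let $1 \leq k \leq m$ be integers and let $$Q(x_1,\ldots,x_m) = \sum_{I \subseteq \{1,\ldots,m\},\ \#I = k} \delta_I \prod_{i \in I} x_i,$$ where the coefficients $\delta_I \in \mathbb{F}_q$ are not all zero. Let $\mathcal{Z} = \{(y_1,\ldots,y_m) \in \mathbb{F}_q^m : Q(y_1,\ldots,y_m) = 0\}$ be the set of zeros of $Q$. Then $$q^{m-k}(q-1)^{k-1} \leq \#\mathcal{Z} \leq q^{m-k}\left(q^k - (q-1)^k\right).$$
   Context: In this paper, a "homogenous polynomial of degree $k$" in the variables $x_1,\ldots,x_m$ over $\mathbb{F}_q$ means a polynomial of the displayed form: an $\mathbb{F}_q$-linear combination, with not all coefficients zero, of the square-free monomials $\prod_{i \in I} x_i$ over subsets $I \subseteq \{1,\ldots,m\}$ of cardinality exactly $k$. $\#$ denotes cardinality. -}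

module Defs where

open import Algebra.Apartness.Bundles using (HeytingField)
open import Data.Bool.Base using (if_then_else_)
open import Data.Fin.Base using (Fin)
open import Data.Fin.Subset using (Subset; inside; outside; ∣_∣)
open import Data.List.Base using (List; []; _∷_; _++_; map; filter; foldr)
open import Data.Nat.Base using (ℕ; zero; suc)
open import Data.Nat.Properties using (_≟_)
open import Data.Product.Base using (Σ; proj₁)
import Data.Vec.Base as Vec
open import Data.Vec.Functional using (Vector)
import Data.Vec.Functional as Vector
import Data.Vec.Functional.Relation.Binary.Equality.Setoid as Pointwise
open import Function.Bundles using (Inverse)
open import Level using (Level; _⊔_)
open import Relation.Binary.Bundles using (Setoid)
import Relation.Binary.Construct.On as On
import Relation.Binary.PropositionalEquality.Properties as ≡

private
  variable
    c ℓ ℓ₁ ℓ₂ : Level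

HasCardinality : Setoid c ℓ → ℕ → Set (c ⊔ ℓ)
HasCardinality S n = Inverse S (≡.setoid (Fin n))

subsets : (m : ℕ) → List (Subset m)
subsets zero    = Vec.[] ∷ []
subsets (suc m) = map (outside Vec.∷_) (subsets m) ++ map (inside Vec.∷_) (subsets m)

subsetsOfSize : (k m : ℕ) → List (Subset m)
subsetsOfSize k m = filter (λ I → ∣ I ∣ ≟ k) (subsets m)

-- A Heyting field whose setoid of elements has a finite cardinality has
-- decidable equality and decidable invertibility, so its tight apartness
-- coincides with _≉_: it is a finite field in the usual sense, with 0 ≉ 1.
module _ (F : HeytingField c ℓ₁ ℓ₂) where
  open HeytingField F

  monomial : {m : ℕ} → Subset m → Vector Carrier m → Carrier
  monomial I y = Vector.foldr _*_ 1# (λ i → if Vec.lookup I i then y i else 1#)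

  -- Only the values of δ at subsets of size k matter.
  evaluate : (k m : ℕ) → (Subset m → Carrier) → Vector Carrier m → Carrier
  evaluate k m δ y =
    foldr _+_ 0# (map (λ I → δ I * monomial I y) (subsetsOfSize k m))

  -- Points are compared coordinatewise; the proofs of vanishing are ignored,
  -- so each zero is counted once.
  zeroSet : (k m : ℕ) → (Subset m → Carrier) → Setoid (c ⊔ ℓ₁) ℓ₁
  zeroSet k m δ =
    On.setoid (Pointwise.≋-setoid setoid m)
              (proj₁ {A = Vector Carrier m} {B = λ y → evaluate k m δ y ≈ 0#})

{-# OPTIONS --safe #-}
-- Write Q = R + x₁ S, with R and S in x₂, …, x_m, where S is homogeneous of
-- degree k ∸ 1.  If S is not the zero polynomial then, over each point where S
-- does not vanish, x₁ ↦ R + x₁ S is a bijection of the field: such a point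
-- lifts to q ∸ 1 nonzeros and to one zero of Q.  If S is the zero polynomial
-- then every nonzero of R lifts to q nonzeros of Q, and every zero to q zeros.
-- By induction Q has at least q^(m∸k) (q∸1)^k nonzeros, which is the upper bound;
-- applied to S, this same bound gives the lower bound on the number of zeros.
module Submission where

open import Defs
open import Algebra.Apartness.Bundles
  using (HeytingField; module HeytingCommutativeRing)
open import Algebra.Bundles using (module CommutativeRing)
import Algebra.Apartness.Properties.HeytingCommutativeRing as HeytingProperties
import Algebra.Properties.CommutativeSemigroup as CommutativeSemigroupProperties
import Algebra.Properties.Ring as RingProperties
open import Data.Bool.Base using (true; false; if_then_else_)
open import Data.Fin.Base using (Fin; zero; suc)
import Data.Fin.Properties as Fin
open import Data.Fin.Subset using (Subset; inside; outside; ∣_∣)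
open import Data.Fin.Subset.Properties using (anySubset?; ∣p∣≤n)
open import Data.List.Base
  using (List; []; _∷_; _++_; map; filter; foldr; length; lookup; tabulate;
         cartesianProductWith)
open import Data.List.Membership.Setoid.Properties
  using (∈-filter⁺; ∈-filter⁻; ∈-lookup; ∈-resp-≈; ∈-cartesianProductWith⁺)
open import Data.List.Properties
  using (filter-all; filter-none; filter-some; filter-++; filter-≐; length-++;
         length-map; length-tabulate)
open import Data.List.Relation.Unary.All as All using (All; []; _∷_)
open import Data.List.Relation.Unary.All.Properties using (all-filter)
open import Data.List.Relation.Unary.AllPairs using ([]; _∷_)
open import Data.List.Relation.Unary.Any as Any using (here; there; index)
import Data.List.Relation.Unary.Any.Properties as Any
open import Data.List.Relation.Unary.Enumerates.Setoid using (IsEnumeration)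
open import Data.List.Relation.Unary.Unique.Setoid using (Unique)
import Data.List.Relation.Unary.Unique.Setoid.Properties as Unique
open import Data.Nat.Base using (ℕ; zero; suc; _+_; _*_; _∸_; _^_; _≤_; z≤n; s≤s)
import Data.Nat.Properties as ℕ
open import Data.Nat.Primality using (Prime)
open import Data.Product.Base using (∃-syntax; _×_; _,_; proj₁; proj₂)
import Data.Vec.Base as Vec
open import Data.Vec.Functional using (Vector; head; tail) renaming (_∷_ to _◂_)
import Data.Vec.Functional.Relation.Binary.Equality.Setoid as Pointwise
open import Function.Base using (_∘_)
open import Function.Bundles using (module Inverse)
open import Function.Properties.Inverse using (Inverse⇒Injection)
open import Level using (Level)
open import Relation.Binary.Bundles using (Setoid)
open import Relation.Binary.Definitions using (_Respects_) renaming (Decidable to Decidable₂)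
import Relation.Binary.Construct.On as On
open import Relation.Binary.PropositionalEquality as ≡ using (_≡_; cong; cong₂; subst)
import Relation.Binary.Reasoning.Setoid as ≈-Reasoning
open import Relation.Nullary using (yes; no; contradiction)
open import Relation.Nullary.Decidable using (¬?; _×-dec_; map′; decidable-stable; via-injection)
open import Relation.Nullary.Negation.Core using (¬_)
open import Relation.Unary using (Pred; Decidable)

private
  variable
    a b d ℓ p r : Level
    A : Set a
    B : Set b
    D : Set d

-- Lengths of filtered lists and of product lists.

module _ {P : Pred B p} (P? : Decidable P) where

  filter-map : (f : A → B) → ∀ xs → filter P? (map f xs) ≡ map f (filter (P? ∘ f) xs)
  filter-map f []       = ≡.refl
  filter-map f (x ∷ xs) with P? (f x)
  ... | yes _ = cong (f x ∷_) (filter-map f xs)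
  ... | no  _ = filter-map f xs

  length-filter-map : (f : A → B) → ∀ xs →
                      length (filter P? (map f xs)) ≡ length (filter (P? ∘ f) xs)
  length-filter-map f xs = ≡.trans (cong length (filter-map f xs))
    (length-map f (filter (P? ∘ f) xs))

  length-filter-∁ : ∀ xs → length (filter P? xs) + length (filter (¬? ∘ P?) xs) ≡ length xs
  length-filter-∁ []       = ≡.refl
  length-filter-∁ (x ∷ xs) with P? x
  ... | yes _ = cong suc (length-filter-∁ xs)
  ... | no  _ = ≡.trans (ℕ.+-suc _ _) (cong suc (length-filter-∁ xs))

length-cartesianProductWith : (f : A → B → D) → ∀ xs ys →
                              length (cartesianProductWith f xs ys) ≡ length xs * length ys
length-cartesianProductWith f []       ys = ≡.refl
length-cartesianProductWith f (x ∷ xs) ys = ≡.trans (length-++ (map (f x) ys))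
  (cong₂ _+_ (length-map (f x) ys) (length-cartesianProductWith f xs ys))

-- Counting by rows: the row of an `x` satisfying `P` contains at least `n` hits. The rows of the
-- other `x` are bounded below by zero only, hence an inequality.
length-filter-cartesianProductWith :
  {P : Pred A p} (P? : Decidable P) {R : Pred D r} (R? : Decidable R) →
  ∀ (f : A → B → D) n ys →
  (∀ x → P x → n ≤ length (filter (R? ∘ f x) ys)) →
  ∀ xs → length (filter P? xs) * n ≤ length (filter R? (cartesianProductWith f xs ys))
length-filter-cartesianProductWith P? R? f n ys fibre []       = z≤n
length-filter-cartesianProductWith P? R? f n ys fibre (x ∷ xs)
  rewrite filter-++ R? (map (f x) ys) (cartesianProductWith f xs ys)
        | length-++ (filter R? (map (f x) ys)) {filter R? (cartesianProductWith f xs ys)}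
        | length-filter-map R? (f x) ys
  with ih ← length-filter-cartesianProductWith P? R? f n ys fibre xs | P? x
... | yes px = ℕ.+-mono-≤ (fibre x px) ih
... | no  _  = ℕ.m≤n⇒m≤o+n _ ih

-- Cardinality of a decidable part of an enumerated setoid.

module _ (S : Setoid a ℓ) where
  open Setoid S

  lookup-injective : ∀ {xs} → Unique S xs → ∀ {i j} → lookup xs i ≈ lookup xs j → i ≡ j
  lookup-injective (_  ∷ _)   {zero}  {zero}  _  = ≡.refl
  lookup-injective (x≉ ∷ _)   {zero}  {suc j} eq =
    contradiction eq (All.lookup x≉ (∈-lookup (≡.setoid _) _ j))
  lookup-injective (x≉ ∷ _)   {suc i} {zero}  eq =
    contradiction (sym eq) (All.lookup x≉ (∈-lookup (≡.setoid _) _ i))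
  lookup-injective (_  ∷ xs!) {suc i} {suc j} eq = cong suc (lookup-injective xs! eq)

  module _ {P : Pred Carrier p} (P? : Decidable P) where

    length-filter-unique : (∀ {x y} → P x → P y → x ≈ y) →
                           ∀ {xs} → Unique S xs → length (filter P? xs) ≤ 1
    length-filter-unique P! []                  = z≤n
    length-filter-unique P! (_∷_ {x} {xs} x≉ xs!) with P? x
    ... | no  _  = length-filter-unique P! xs!
    -- After the first hit every later element fails `P`: a second hit would be equal to the first,
    -- against uniqueness of the list.
    ... | yes px = s≤s (ℕ.≤-reflexive (cong length
                     (filter-none P? (All.map (λ x≉y py → x≉y (P! px py)) x≉))))

    -- An element corresponds to its position in the filtered list: the enumeration makes the
    -- position exist, and freedom from duplicates makes it unique.
    hasCardinality-filter :
      P Respects _≈_ → ∀ {xs} → Unique S xs → IsEnumeration S xs →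
      HasCardinality (On.setoid S (proj₁ {B = P})) (length (filter P? xs))
    hasCardinality-filter resp {xs} xs! enum = record
      { to        = position
      ; from      = λ i → lookup ys i , proj₂ (∈-filter⁻ S P? resp {xs = xs} (∈-lookup S ys i))
      ; to-cong   = λ {x} {y} x≈y → position-unique x
                      (trans x≈y (lookup-position y))
      ; from-cong = λ { ≡.refl → refl }
      ; inverse   = (λ {i} {x} x≈yᵢ → position-unique x x≈yᵢ)
                  , (λ { {x} ≡.refl → sym (lookup-position x) })
      }
      where
      ys = filter P? xs

      located : ∀ x → Any.Any (proj₁ x ≈_) ys
      located (x , px) = ∈-filter⁺ S P? resp (enum x) px

      position : ∃[ x ] P x → Fin (length ys)
      position x = index (located x)

      lookup-position : ∀ x → proj₁ x ≈ lookup ys (position x)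
      lookup-position x = Any.lookup-index (located x)

      -- Source of both the congruence of `position` and its left inverse law; in particular the
      -- position does not depend on the proof of `P` carried by `x`.
      position-unique : ∀ x {i} → proj₁ x ≈ lookup ys i → position x ≡ i
      position-unique x x≈yᵢ = lookup-injective (Unique.filter⁺ S P? xs!)
        (trans (sym (lookup-position x)) x≈yᵢ)

-- Splitting off the first variable.

module Polynomial {c ℓ₁ ℓ₂} (F : HeytingField c ℓ₁ ℓ₂) where

  open HeytingField F hiding (_+_; _*_; zero)
  open HeytingField F using () renaming (_+_ to _⊕_; _*_ to _⊗_)
  open CommutativeRing (HeytingCommutativeRing.commutativeRing heytingCommutativeRing)
    using (ring; *-commutativeSemigroup)
  open RingProperties ring using (+-cancelˡ)
  open HeytingProperties heytingCommutativeRing using (x-0≈x)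
  open CommutativeSemigroupProperties *-commutativeSemigroup using (x∙yz≈y∙xz)
  open Setoid setoid using (_≉_)
  open Pointwise setoid using (_≋_; ≋-setoid; foldr-cong)

  private
    variable
      k m : ℕ

  -- The sum in `evaluate` with its list of subsets left free, so that it can be split along `_++_`
  -- and treated by induction on the list.
  combination : (Subset m → Carrier) → Vector Carrier m → List (Subset m) → Carrier
  combination δ y Is = foldr _⊕_ 0# (map (λ I → δ I ⊗ monomial F I y) Is)

  combination-++ : ∀ (δ : Subset m → Carrier) y Is {Js} →
                   combination δ y (Is ++ Js) ≈ combination δ y Is ⊕ combination δ y Js
  combination-++ δ y []       = sym (+-identityˡ _)
  combination-++ δ y (I ∷ Is) = trans (+-congˡ (combination-++ δ y Is)) (sym (+-assoc _ _ _))

  combination-outside : ∀ (δ : Subset (suc m) → Carrier) y Is →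
    combination δ y (map (outside Vec.∷_) Is) ≈ combination (δ ∘ (outside Vec.∷_)) (tail y) Is
  combination-outside δ y []       = refl
  combination-outside δ y (I ∷ Is) =
    +-cong (*-congˡ (*-identityˡ _)) (combination-outside δ y Is)

  combination-inside : ∀ (δ : Subset (suc m) → Carrier) y Is →
    combination δ y (map (inside Vec.∷_) Is) ≈
    head y ⊗ combination (δ ∘ (inside Vec.∷_)) (tail y) Is
  combination-inside δ y []       = sym (zeroʳ _)
  combination-inside δ y (I ∷ Is) = begin
    δI ⊗ (x ⊗ mI) ⊕ combination δ y (map (inside Vec.∷_) Is)
      ≈⟨ +-cong (x∙yz≈y∙xz δI x mI) (combination-inside δ y Is) ⟩
    x ⊗ (δI ⊗ mI) ⊕ x ⊗ combination (δ ∘ (inside Vec.∷_)) (tail y) Is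
      ≈⟨ distribˡ x _ _ ⟨
    x ⊗ (δI ⊗ mI ⊕ combination (δ ∘ (inside Vec.∷_)) (tail y) Is) ∎
    where
    open ≈-Reasoning setoid
    x  = head y
    δI = δ (inside Vec.∷ I)
    mI = monomial F I (tail y)

  filter-outside : ∀ k (Is : List (Subset m)) →
    filter (λ I → ∣ I ∣ ℕ.≟ k) (map (outside Vec.∷_) Is) ≡
    map (outside Vec.∷_) (filter (λ I → ∣ I ∣ ℕ.≟ k) Is)
  filter-outside k = filter-map (λ I → ∣ I ∣ ℕ.≟ k) (outside Vec.∷_)

  filter-inside : ∀ k (Is : List (Subset m)) →
    filter (λ I → ∣ I ∣ ℕ.≟ suc k) (map (inside Vec.∷_) Is) ≡
    map (inside Vec.∷_) (filter (λ I → ∣ I ∣ ℕ.≟ k) Is)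
  filter-inside k Is = ≡.trans
    (filter-map (λ I → ∣ I ∣ ℕ.≟ suc k) (inside Vec.∷_) Is)
    (cong (map (inside Vec.∷_)) (filter-≐ _ _ (ℕ.suc-injective , cong suc) Is))

  filter-inside-zero : (Is : List (Subset m)) →
    filter (λ I → ∣ I ∣ ℕ.≟ 0) (map (inside Vec.∷_) Is) ≡ []
  filter-inside-zero Is = ≡.trans
    (filter-map (λ I → ∣ I ∣ ℕ.≟ 0) (inside Vec.∷_) Is)
    (cong (map (inside Vec.∷_)) (filter-none _ (All.universal (λ _ ()) Is)))

  -- No subset of size 0 contains the first index, so in degree 0 there is no `S` part and `Q` is
  -- just `R`.
  evaluate-zero : ∀ (δ : Subset (suc m) → Carrier) y →
    evaluate F 0 (suc m) δ y ≈ evaluate F 0 m (δ ∘ (outside Vec.∷_)) (tail y)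
  evaluate-zero {m} δ y
    rewrite filter-++ (λ I → ∣ I ∣ ℕ.≟ 0) (map (outside Vec.∷_) (subsets m))
                      (map (inside Vec.∷_) (subsets m))
          | filter-outside 0 (subsets m)
          | filter-inside-zero (subsets m)
    = trans (combination-++ δ y (map (outside Vec.∷_) (subsetsOfSize 0 m)))
        (trans (+-identityʳ _) (combination-outside δ y (subsetsOfSize 0 m)))

  -- The decomposition `Q = R + x₁ S`: subsets avoiding the first index give `R`, and those
  -- containing it give `S` after the index is removed, which lowers the degree by one.
  evaluate-suc : ∀ k (δ : Subset (suc m) → Carrier) y →
    evaluate F (suc k) (suc m) δ y ≈
    evaluate F (suc k) m (δ ∘ (outside Vec.∷_)) (tail y) ⊕
    head y ⊗ evaluate F k m (δ ∘ (inside Vec.∷_)) (tail y)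
  evaluate-suc {m} k δ y
    rewrite filter-++ (λ I → ∣ I ∣ ℕ.≟ suc k) (map (outside Vec.∷_) (subsets m))
                      (map (inside Vec.∷_) (subsets m))
          | filter-outside (suc k) (subsets m)
          | filter-inside k (subsets m)
    = trans (combination-++ δ y (map (outside Vec.∷_) (subsetsOfSize (suc k) m)))
        (+-cong (combination-outside δ y (subsetsOfSize (suc k) m))
                (combination-inside δ y (subsetsOfSize k m)))

  -- Dependence on the point, and vanishing of the coefficients.

  monomial-cong : ∀ (I : Subset m) {y z} → y ≋ z → monomial F I y ≈ monomial F I z
  monomial-cong I {y} {z} y≋z = foldr-cong *-cong refl choose-cong
    where
    choose-cong : ∀ i → (if Vec.lookup I i then y i else 1#) ≈
                        (if Vec.lookup I i then z i else 1#)
    choose-cong i with Vec.lookup I i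
    ... | true  = y≋z i
    ... | false = refl

  evaluate-cong : ∀ k (δ : Subset m → Carrier) {y z} → y ≋ z →
                  evaluate F k m δ y ≈ evaluate F k m δ z
  evaluate-cong {m} k δ {y} {z} y≋z = go (subsetsOfSize k m)
    where
    go : ∀ Is → combination δ y Is ≈ combination δ z Is
    go []       = refl
    go (I ∷ Is) = +-cong (*-congˡ (monomial-cong I y≋z)) (go Is)

  -- Being the zero polynomial is expressed through coefficients rather than values; it splits along
  -- the first variable and is decidable by finite search.
  Vanishing : ∀ k m → Pred (Subset m → Carrier) ℓ₁
  Vanishing k m δ = ∀ I → ∣ I ∣ ≡ k → δ I ≈ 0#

  evaluate-vanishing : ∀ k (δ : Subset m → Carrier) → Vanishing k m δ →
                       ∀ y → evaluate F k m δ y ≈ 0#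
  evaluate-vanishing {m} k δ δ≈0 y = go (all-filter (λ I → ∣ I ∣ ℕ.≟ k) (subsets m))
    where
    go : ∀ {Is} → All (λ I → ∣ I ∣ ≡ k) Is → combination δ y Is ≈ 0#
    go []                     = refl
    go (_∷_ {I} ∣I∣≡k ∣Is∣≡k) =
      trans (+-cong (trans (*-congʳ (δ≈0 I ∣I∣≡k)) (zeroˡ _)) (go ∣Is∣≡k)) (+-identityˡ 0#)

  -- For `k` above `m` there is no subset of size `k`, so all coefficients vanish vacuously. This
  -- keeps the truncated exponent `m ∸ k` honest in the inductions.
  nonvanishing⇒k≤m : ∀ k {δ : Subset m → Carrier} → ¬ Vanishing k m δ → k ≤ m
  nonvanishing⇒k≤m {m} k δ≉0 with k ℕ.≤? m
  ... | yes k≤m = k≤m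
  ... | no  k≰m = contradiction (λ { I ≡.refl → contradiction (∣p∣≤n I) k≰m }) δ≉0

  vanishing-suc : ∀ {δ : Subset (suc m) → Carrier} →
    Vanishing (suc k) m (δ ∘ (outside Vec.∷_)) → Vanishing k m (δ ∘ (inside Vec.∷_)) →
    Vanishing (suc k) (suc m) δ
  vanishing-suc R≈0 S≈0 (outside Vec.∷ I) ∣I∣≡1+k = R≈0 I ∣I∣≡1+k
  vanishing-suc R≈0 S≈0 (inside  Vec.∷ I) ∣I∣≡1+k = S≈0 I (ℕ.suc-injective ∣I∣≡1+k)

  vanishing-zero : ∀ {δ : Subset (suc m) → Carrier} →
    Vanishing 0 m (δ ∘ (outside Vec.∷_)) → Vanishing 0 (suc m) δ
  vanishing-zero R≈0 (outside Vec.∷ I) ∣I∣≡0 = R≈0 I ∣I∣≡0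

  -- Decidability, inverses and affine equations over a finite field.

  module Finite {q : ℕ} (card : HasCardinality setoid q) where

    open Inverse card

    infix 4 _≈?_

    _≈?_ : Decidable₂ _≈_
    _≈?_ = via-injection (Inverse⇒Injection card) Fin._≟_

    -- Searches all subsets for a nonzero coefficient in degree `k`; the inductions split on the
    -- outcome for `S`.
    vanishing? : ∀ k m → Decidable (Vanishing k m)
    vanishing? k m δ = map′
      (λ ∄I I ∣I∣≡k → decidable-stable (δ I ≈? 0#) (λ δI≉0 → ∄I (I , ∣I∣≡k , δI≉0)))
      (λ { δ≈0 (I , ∣I∣≡k , δI≉0) → δI≉0 (δ≈0 I ∣I∣≡k) })
      (¬? (anySubset? (λ I → (∣ I ∣ ℕ.≟ k) ×-dec ¬? (δ I ≈? 0#))))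

    -- Tightness only makes s ≉ 0# doubly negated apartness from 0#; an actual
    -- inverse comes from searching the finite carrier.
    ≉0⇒inverseʳ : ∀ {s} → s ≉ 0# → ∃[ t ] s ⊗ t ≈ 1#
    ≉0⇒inverseʳ {s} s≉0 with Fin.any? (λ i → s ⊗ from i ≈? 1#)
    ... | yes (i , eq) = from i , eq
    ... | no  ∄i       = contradiction (proj₁ (tight s 0#) ¬s#0) s≉0
      where
      ¬s#0 : ¬ (s # 0#)
      ¬s#0 s#0 with #⇒invertible s#0
      ... | t , _ , [s-0]t≈1 = ∄i (to t , trans
        (*-cong (sym (x-0≈x s)) (strictlyInverseʳ t)) [s-0]t≈1)

    module _ {r s : Carrier} (s≉0 : s ≉ 0#) where

      open ≈-Reasoning setoid

      private
        t = proj₁ (≉0⇒inverseʳ s≉0)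

        cancel : ∀ x → (x ⊗ s) ⊗ t ≈ x
        cancel x = trans (*-assoc x s t)
          (trans (*-congˡ (proj₂ (≉0⇒inverseʳ s≉0))) (*-identityʳ x))

      affine-root-unique : ∀ {x y} → r ⊕ x ⊗ s ≈ 0# → r ⊕ y ⊗ s ≈ 0# → x ≈ y
      affine-root-unique {x} {y} x-root y-root = begin
        x           ≈⟨ cancel x ⟨
        (x ⊗ s) ⊗ t ≈⟨ *-congʳ (+-cancelˡ r _ _ (trans x-root (sym y-root))) ⟩
        (y ⊗ s) ⊗ t ≈⟨ cancel y ⟩
        y           ∎

      affine-root : ∃[ x ] r ⊕ x ⊗ s ≈ 0#
      -- The root is `- r` divided by `s`, with `t` the inverse of `s`.
      affine-root = (- r) ⊗ t , (begin
        r ⊕ ((- r) ⊗ t) ⊗ s ≈⟨ +-congˡ (trans (*-assoc _ t s)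
                                (trans (*-congˡ (*-comm t s)) (sym (*-assoc _ s t)))) ⟩
        r ⊕ ((- r) ⊗ s) ⊗ t ≈⟨ +-congˡ (cancel (- r)) ⟩
        r ⊕ (- r)           ≈⟨ -‿inverseʳ r ⟩
        0#                  ∎)

    -- Enumerating the points of affine space and counting along fibres.

    elements : List Carrier
    elements = tabulate from

    length-elements : length elements ≡ q
    length-elements = length-tabulate from

    elements-unique : Unique setoid elements
    elements-unique = Unique.tabulate⁺ setoid
      (λ {i} {j} eq → ≡.trans (≡.sym (strictlyInverseˡ i))
                     (≡.trans (to-cong eq) (strictlyInverseˡ j)))

    elements-enumeration : IsEnumeration setoid elements
    elements-enumeration x = Any.tabulate⁺ (to x) (sym (strictlyInverseʳ x))

    -- The tail `y` runs in the outer list and the first coordinate `x` in the inner one, so each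
    -- row is a fibre of the projection that forgets the first coordinate.
    points : ∀ m → List (Vector Carrier m)
    points zero    = (λ ()) ∷ []
    points (suc m) = cartesianProductWith (λ y x → x ◂ y) (points m) elements

    length-points : ∀ m → length (points m) ≡ q ^ m
    length-points zero    = ≡.refl
    length-points (suc m) = ≡.trans (length-cartesianProductWith _ (points m) elements)
      (≡.trans (cong₂ _*_ (length-points m) length-elements) (ℕ.*-comm (q ^ m) q))

    points-unique : ∀ m → Unique (≋-setoid m) (points m)
    points-unique zero    = [] ∷ []
    points-unique (suc m) = Unique.cartesianProductWith⁺ (≋-setoid m) setoid (≋-setoid (suc m))
      _ (λ eq → eq ∘ suc , eq zero) (points-unique m) elements-unique

    points-enumeration : ∀ m → IsEnumeration (≋-setoid m) (points m)
    points-enumeration zero    y = here (λ ())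
    points-enumeration (suc m) y = ∈-resp-≈ (≋-setoid (suc m))
      -- A functional vector agrees with `head y ◂ tail y` only pointwise, so membership is
      -- transported along this equality.
      (λ { zero → refl ; (suc i) → refl })
      (∈-cartesianProductWith⁺ (≋-setoid m) setoid (≋-setoid (suc m))
        (λ { y≋z x≈w zero → x≈w ; y≋z x≈w (suc i) → y≋z i })
        (points-enumeration m (tail y)) (elements-enumeration (head y)))

    #points : {P : Pred (Vector Carrier m) ℓ} → Decidable P → ℕ
    #points {m} P? = length (filter P? (points m))

    module _ {P : Pred (Vector Carrier m) p} (P? : Decidable P)
             {R : Pred (Vector Carrier (suc m)) r} (R? : Decidable R) where

      #points-fibre : ∀ n → (∀ y → P y → n ≤ length (filter (λ x → R? (x ◂ y)) elements)) →
                      #points P? * n ≤ #points R?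
      #points-fibre n fibre = length-filter-cartesianProductWith P? R? _ n elements fibre (points m)

      -- The case of full fibres: over a point of `P` all `q` values of the first coordinate count.
      #points-cylinder : (∀ y x → P y → R (x ◂ y)) → q * #points P? ≤ #points R?
      #points-cylinder P⇒R = subst (_≤ #points R?) (ℕ.*-comm _ q) (#points-fibre q λ y py →
        ℕ.≤-reflexive (≡.sym (≡.trans
          (cong length (filter-all (λ x → R? (x ◂ y)) (All.universal (λ x → P⇒R y x py) elements)))
          length-elements)))

    zero? : ∀ k (δ : Subset m → Carrier) → Decidable (λ y → evaluate F k m δ y ≈ 0#)
    zero? k δ y = evaluate F k _ δ y ≈? 0#

    #zeros #nonzeros : ∀ k (δ : Subset m → Carrier) → ℕ
    #zeros    k δ = #points (zero? k δ)
    #nonzeros k δ = #points (¬? ∘ zero? k δ)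

    #zeros+#nonzeros : ∀ k (δ : Subset m → Carrier) → #zeros k δ + #nonzeros k δ ≡ q ^ m
    #zeros+#nonzeros {m} k δ = ≡.trans (length-filter-∁ (zero? k δ) (points m)) (length-points m)

    zeroSet-hasCardinality : ∀ k (δ : Subset m → Carrier) →
                             HasCardinality (zeroSet F k m δ) (#zeros k δ)
    zeroSet-hasCardinality {m} k δ = hasCardinality-filter (≋-setoid m) (zero? k δ)
      (λ y≋z y-zero → trans (sym (evaluate-cong k δ y≋z)) y-zero)
      (points-unique m) (points-enumeration m)

    -- Zeros and nonzeros of `Q` over a point of the remaining variables.

    module _ (k : ℕ) (δ : Subset (suc m) → Carrier) where

      private
        δₒ δᵢ : Subset m → Carrier
        δₒ = δ ∘ (outside Vec.∷_)
        δᵢ = δ ∘ (inside Vec.∷_)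

        root : ∀ x y → Set ℓ₁
        root x y = evaluate F (suc k) (suc m) δ (x ◂ y) ≈ 0#

        root? : ∀ y → Decidable (λ x → root x y)
        root? y x = zero? (suc k) δ (x ◂ y)

        -- Over `y`, `Q` is affine in the first coordinate with slope `S(y)`. A nonzero slope leaves
        -- at most one root, and the solution of the affine equation is met by some listed element.
        one-root : ∀ y → evaluate F k m δᵢ y ≉ 0# → length (filter (root? y) elements) ≡ 1
        one-root y s≉0 = ℕ.≤-antisym
          (length-filter-unique setoid (root? y)
            (λ {x} {z} x-root z-root → affine-root-unique s≉0
              (trans (sym (evaluate-suc k δ (x ◂ y))) x-root)
              (trans (sym (evaluate-suc k δ (z ◂ y))) z-root))
            elements-unique)
          (filter-some (root? y) (Any.map
            (λ {x} x₀≈x → trans (evaluate-suc k δ (x ◂ y))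
              (trans (+-congˡ (*-congʳ (sym x₀≈x))) (proj₂ (affine-root s≉0))))
            (elements-enumeration (proj₁ (affine-root s≉0)))))

      #nonzeros≤#zeros : #nonzeros k δᵢ ≤ #zeros (suc k) δ
      #nonzeros≤#zeros = subst (_≤ #zeros (suc k) δ) (ℕ.*-identityʳ _)
        (#points-fibre (¬? ∘ zero? k δᵢ) (zero? (suc k) δ) 1
          (λ y s≉0 → ℕ.≤-reflexive (≡.sym (one-root y s≉0))))

      #nonzeros-inside : #nonzeros k δᵢ * (q ∸ 1) ≤ #nonzeros (suc k) δ
      #nonzeros-inside = #points-fibre (¬? ∘ zero? k δᵢ) (¬? ∘ zero? (suc k) δ) (q ∸ 1)
        -- Roots and nonroots in the fibre add up to `q`, and there is one root; subtracting 1 then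
        -- computes to the number of nonroots.
        (λ y s≉0 → ℕ.≤-reflexive (cong (_∸ 1) (≡.trans (≡.sym length-elements)
          (≡.trans (≡.sym (length-filter-∁ (root? y) elements))
                   (cong (_+ length (filter (¬? ∘ root? y) elements)) (one-root y s≉0))))))

      module _ (δᵢ≈0 : Vanishing k m δᵢ) where

        private
          evaluate-outside : ∀ y x → evaluate F (suc k) (suc m) δ (x ◂ y) ≈
                                     evaluate F (suc k) m δₒ y
          evaluate-outside y x = trans (evaluate-suc k δ (x ◂ y)) (trans
            (+-congˡ (trans (*-congˡ (evaluate-vanishing k δᵢ δᵢ≈0 y)) (zeroʳ x)))
            (+-identityʳ _))

        #zeros-outside : q * #zeros (suc k) δₒ ≤ #zeros (suc k) δ
        #zeros-outside = #points-cylinder _ _ (λ y x → trans (evaluate-outside y x))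

        #nonzeros-outside : q * #nonzeros (suc k) δₒ ≤ #nonzeros (suc k) δ
        #nonzeros-outside = #points-cylinder _ _
          (λ y x r≉0 → r≉0 ∘ trans (sym (evaluate-outside y x)))

    -- The bounds by induction on the number of variables.

    q^[1+m∸k]≡q*q^[m∸k] : k ≤ m → q ^ (suc m ∸ k) ≡ q * q ^ (m ∸ k)
    q^[1+m∸k]≡q*q^[m∸k] k≤m = cong (q ^_) (ℕ.+-∸-assoc 1 k≤m)

    -- The inductive step when `Q` is free of the first variable: the count and the bound both gain
    -- a factor `q`. The factor `b` stands for the power of `q ∸ 1`, which does not involve `m`.
    lift-bound : k ≤ m → ∀ {b n N} → q ^ (m ∸ k) * b ≤ n → q * n ≤ N → q ^ (suc m ∸ k) * b ≤ N
    lift-bound {k} {m} k≤m {b} {n} {N} bound qn≤N = begin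
      q ^ (suc m ∸ k) * b   ≡⟨ cong (_* b) (q^[1+m∸k]≡q*q^[m∸k] k≤m) ⟩
      q * q ^ (m ∸ k) * b   ≡⟨ ℕ.*-assoc q _ b ⟩
      q * (q ^ (m ∸ k) * b) ≤⟨ ℕ.*-monoʳ-≤ q bound ⟩
      q * n                 ≤⟨ qn≤N ⟩
      N                     ∎
      where open ℕ.≤-Reasoning

    #nonzeros-lowerBound : ∀ k m (δ : Subset m → Carrier) → ¬ Vanishing k m δ →
                           q ^ (m ∸ k) * (q ∸ 1) ^ k ≤ #nonzeros k δ
    -- The bound computes to 1, and the only point is a nonzero because `Q` is the constant
    -- coefficient at the empty subset.
    #nonzeros-lowerBound zero zero δ δ≉0 = filter-some (¬? ∘ zero? 0 δ)
      (here λ δ∅≈0 → δ≉0 λ { Vec.[] _ →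
        trans (sym (trans (+-identityʳ _) (*-identityʳ _))) δ∅≈0 })
    #nonzeros-lowerBound zero (suc m) δ δ≉0 = lift-bound {m = m} z≤n
      (#nonzeros-lowerBound zero m (δ ∘ (outside Vec.∷_)) (δ≉0 ∘ vanishing-zero))
      (#points-cylinder _ _ (λ y x r≉0 → r≉0 ∘ trans (sym (evaluate-zero δ (x ◂ y)))))
    #nonzeros-lowerBound (suc k) zero δ δ≉0 = contradiction (λ { Vec.[] () }) δ≉0
    #nonzeros-lowerBound (suc k) (suc m) δ δ≉0 with vanishing? k m (δ ∘ (inside Vec.∷_))
    -- Since `S` vanishes, `R` cannot; hence `suc k ≤ m`, and the induction continues with `R` in
    -- the same degree.
    ... | yes S≈0 = lift-bound (nonvanishing⇒k≤m (suc k) R≉0)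
            (#nonzeros-lowerBound (suc k) m (δ ∘ (outside Vec.∷_)) R≉0)
            (#nonzeros-outside k δ S≈0)
      where
      R≉0 : ¬ Vanishing (suc k) m (δ ∘ (outside Vec.∷_))
      R≉0 R≈0 = δ≉0 (vanishing-suc R≈0 S≈0)
    -- The exponent `suc m ∸ suc k` computes to `m ∸ k`, so compared with the bound for `S` only one
    -- factor `q ∸ 1` is gained.
    ... | no  S≉0 = begin
      q ^ (m ∸ k) * ((q ∸ 1) * (q ∸ 1) ^ k) ≡⟨ cong (q ^ (m ∸ k) *_) (ℕ.*-comm (q ∸ 1) _) ⟩
      q ^ (m ∸ k) * ((q ∸ 1) ^ k * (q ∸ 1)) ≡⟨ ℕ.*-assoc (q ^ (m ∸ k)) _ _ ⟨
      q ^ (m ∸ k) * (q ∸ 1) ^ k * (q ∸ 1)   ≤⟨ ℕ.*-monoˡ-≤ (q ∸ 1) (#nonzeros-lowerBound k m S S≉0) ⟩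
      #nonzeros k S * (q ∸ 1)               ≤⟨ #nonzeros-inside k δ ⟩
      #nonzeros (suc k) δ                   ∎
      where
      open ℕ.≤-Reasoning
      S = δ ∘ (inside Vec.∷_)

    -- The degree is a successor because a nonzero constant has no zeros.
    #zeros-lowerBound : ∀ k m (δ : Subset m → Carrier) → ¬ Vanishing (suc k) m δ →
                        q ^ (m ∸ suc k) * (q ∸ 1) ^ k ≤ #zeros (suc k) δ
    #zeros-lowerBound k zero    δ δ≉0 = contradiction (λ { Vec.[] () }) δ≉0
    #zeros-lowerBound k (suc m) δ δ≉0 with vanishing? k m (δ ∘ (inside Vec.∷_))
    -- No recursion here: the bound on nonzeros of `S`, of degree `k` in `m` variables, is already
    -- the claimed number.
    ... | no  S≉0 = ℕ.≤-trans (#nonzeros-lowerBound k m _ S≉0) (#nonzeros≤#zeros k δ)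
    ... | yes S≈0 = lift-bound (nonvanishing⇒k≤m (suc k) R≉0)
            (#zeros-lowerBound k m (δ ∘ (outside Vec.∷_)) R≉0)
            (#zeros-outside k δ S≈0)
      where
      R≉0 : ¬ Vanishing (suc k) m (δ ∘ (outside Vec.∷_))
      R≉0 R≈0 = δ≉0 (vanishing-suc R≈0 S≈0)

    #zeros-upperBound : ∀ k m (δ : Subset m → Carrier) → ¬ Vanishing k m δ →
                        #zeros k δ ≤ q ^ (m ∸ k) * (q ^ k ∸ (q ∸ 1) ^ k)
    #zeros-upperBound k m δ δ≉0 = begin
      #zeros k δ
        ≡⟨ ℕ.m+n∸n≡m _ (#nonzeros k δ) ⟨
      #zeros k δ + #nonzeros k δ ∸ #nonzeros k δ
        ≡⟨ cong (_∸ #nonzeros k δ) (#zeros+#nonzeros k δ) ⟩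
      q ^ m ∸ #nonzeros k δ
        ≤⟨ ℕ.∸-monoʳ-≤ (q ^ m) (#nonzeros-lowerBound k m δ δ≉0) ⟩
      q ^ m ∸ bound
        -- As `k ≤ m`, the factor `q ^ (m ∸ k)` can be split off from `q ^ m` and shared with
        -- `bound`.
        ≡⟨ cong (λ n → q ^ n ∸ bound) (ℕ.m∸n+n≡m (nonvanishing⇒k≤m k δ≉0)) ⟨
      q ^ (m ∸ k + k) ∸ bound
        ≡⟨ cong (_∸ bound) (ℕ.^-distribˡ-+-* q (m ∸ k) k) ⟩
      q ^ (m ∸ k) * q ^ k ∸ bound
        ≡⟨ ℕ.*-distribˡ-∸ (q ^ (m ∸ k)) _ _ ⟨
      q ^ (m ∸ k) * (q ^ k ∸ (q ∸ 1) ^ k) ∎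
      where
      open ℕ.≤-Reasoning
      bound = q ^ (m ∸ k) * (q ∸ 1) ^ k

theorem1 : ∀ {c ℓ₁ ℓ₂} (p l q : ℕ) → Prime p → 1 ≤ l → q ≡ p ^ l →
    (F : HeytingField c ℓ₁ ℓ₂) → let module F = HeytingField F in
    HasCardinality F.setoid q →
    (k m : ℕ) → 1 ≤ k → k ≤ m →
    (δ : Subset m → F.Carrier) →
    ¬ (∀ (I : Subset m) → ∣ I ∣ ≡ k → δ I F.≈ F.0#) →
    ∃[ N ] (HasCardinality (zeroSet F k m δ) N
    × q ^ (m ∸ k) * (q ∸ 1) ^ (k ∸ 1) ≤ N
    × N ≤ q ^ (m ∸ k) * (q ^ k ∸ (q ∸ 1) ^ k))
-- With the degree a successor, the exponent `suc k ∸ 1` computes to `k`.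
theorem1 p l q _ _ _ F card (suc k) m _ _ δ δ≉0 =
  #zeros (suc k) δ
  , zeroSet-hasCardinality (suc k) δ
  , #zeros-lowerBound k m δ δ≉0
  , #zeros-upperBound (suc k) m δ δ≉0
  where
  open Polynomial F
  open Finite card
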